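{- For sets without proper arithmetic progressions of length $4$ the following exact values hold: $r_4(\mathbb{Z}_4^1)=3$, $r_4(\mathbb{Z}_4^2)=10$, $r_4(\mathbb{Z}_4^3)=36$, and $r_4(\mathbb{Z}_4^4)=128$.
   Context: $\mathbb{Z}_m^n$ denotes the additive group $(\mathbb{Z}/m\mathbb{Z})^n$. A proper arithmetic progression of length $k$ in $\mathbb{Z}_m^n$ is a sequence $x, x+d, \ldots, x+(k-1)d$ (with $x,d\in\mathbb{Z}_m^n$) whose $k$ elements are pairwise distinct. $r_k(\mathbb{Z}_m^n)$ denotes the maximal size of a set $S\subseteq\mathbb{Z}_m^n$ that does not contain a proper arithmetic progression of length $k$. -}

module Defs where

open import Algebra.Bundles.Raw using (RawMonoid)
import Algebra.Definitions.RawMonoid as Multiple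
open import Data.Fin.Base using (Fin; toℕ)
open import Data.List.Base using (List; length)
open import Data.List.Membership.Propositional using (_∈_)
open import Data.List.Relation.Unary.Unique.Propositional using (Unique)
open import Data.Nat.Base using (ℕ; NonZero; _≤_; _+_)
open import Data.Nat.DivMod using (_mod_)
open import Data.Product.Base using (∃; ∃₂; _×_)
open import Data.Vec.Base using (Vec; replicate; zipWith)
open import Function.Definitions using (Injective)
open import Level using (0ℓ)
open import Relation.Binary.PropositionalEquality.Core using (_≡_)
open import Relation.Nullary.Negation.Core using (¬_)

-- Each residue class mod m is represented by its least non-negative
-- representative, so propositional equality is equality in ℤ/m.
ℤmod : ℕ → ℕ → Set
ℤmod m n = Vec (Fin m) n

module _ {m : ℕ} .{{_ : NonZero m}} where

  _+ₘ_ : Fin m → Fin m → Fin m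
  a +ₘ b = (toℕ a + toℕ b) mod m

  0ₘ : Fin m
  0ₘ = 0 mod m

  infixl 6 _⊕_
  _⊕_ : ∀ {n} → ℤmod m n → ℤmod m n → ℤmod m n
  _⊕_ = zipWith _+ₘ_

  ℤmod-rawMonoid : ℕ → RawMonoid 0ℓ 0ℓ
  ℤmod-rawMonoid n = record
    { Carrier = ℤmod m n
    ; _≈_     = _≡_
    ; _∙_     = _⊕_
    ; ε       = replicate n 0ₘ
    }

  infixr 7 _·_
  _·_ : ∀ {n} → ℕ → ℤmod m n → ℤmod m n
  _·_ {n} = Multiple._×_ (ℤmod-rawMonoid n)

  progression : ∀ {n} (k : ℕ) → ℤmod m n → ℤmod m n → Fin k → ℤmod m n
  progression k x d i = x ⊕ toℕ i · d

  Proper : ∀ {n} (k : ℕ) → ℤmod m n → ℤmod m n → Set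
  Proper k x d = Injective _≡_ _≡_ (progression k x d)

  ContainsProperAP : ∀ {n} → ℕ → List (ℤmod m n) → Set
  ContainsProperAP k S =
    ∃₂ λ x d → Proper k x d × (∀ i → progression k x d i ∈ S)

-- A set S ⊆ (ℤ/m)ⁿ is listed without repetition, so that ∣S∣ = length S.
APFreeSetOfSize : (k m n : ℕ) .{{_ : NonZero m}} → ℕ → Set
APFreeSetOfSize k m n s =
  ∃ λ (S : List (ℤmod m n)) →
    Unique S × ¬ ContainsProperAP k S × length S ≡ s

IsMaximum : (ℕ → Set) → ℕ → Set
IsMaximum P N = P N × (∀ s → P s → s ≤ N)

-- r[ k , m , n ]≡ N  says that rₖ(ℤₘⁿ) = N.
r[_,_,_]≡_ : (k m n : ℕ) .{{_ : NonZero m}} → ℕ → Set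
r[ k , m , n ]≡ N = IsMaximum (APFreeSetOfSize k m n) N

{-# OPTIONS --safe #-}
module Submission where

-- Write x ∈ (ℤ/4)ⁿ as a + 2b with a, b ∈ (ℤ/2)ⁿ and split S into the fibres F a = {b : a + 2b ∈ S}.
-- A proper progression with difference d ≡ δ (mod 2), δ ≠ 0, consists of two arbitrary pairs of
-- difference δ, one in F a and one in F (a + δ). So S is progression-free iff, for all a and δ ≠ 0,
-- not both of F a and F (a + δ) have the difference δ. A fibre with more than 2ⁿ⁻¹ elements has all
-- differences, hence there is at most one, and ∣S∣ ≤ 2ⁿ + (2ⁿ − 1) 2ⁿ⁻¹. This is sharp for n ≤ 3.
--
-- For n = 4 without such a fibre, ∣S∣ ≤ 16 · 8 = 128. Otherwise let it be F 0; then b is not a difference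
-- of F b for b ≠ 0. If two fibres have at most 4 elements, then ∣S∣ ≤ 16 + 13 · 8 + 2 · 4 = 128. If all
-- fibres over b ≠ 0, s have more than 4, the sets E b of differences avoided by F b contain b, contain
-- no line {u, v, u + v} (by packing translates of F b), and b + c ∈ E b ∪ E c. Then membership
-- y ∈ E x orients cyclically every line of PG(3,2) missing s, and a parity count over the nine pairs
-- of points on two skew lines gives a contradiction.

open import Defs
open import Data.Bool.Base using (Bool; true; false; T; not; _∧_; _xor_; if_then_else_)
open import Data.Bool.Properties using (T?; xor-assoc; xor-comm; xor-identityˡ; xor-same) renaming (_≟_ to _≟ᴮ_)
open import Data.Empty using (⊥; ⊥-elim)
open import Data.Fin.Base using (Fin; zero; suc)
import Data.Fin.Properties as Fin
open import Data.List.Base using (List; []; _∷_; length; map; filter; cartesianProduct; cartesianProductWith)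
open import Data.List.Membership.Propositional using (_∈_)
import Data.List.Membership.DecPropositional as DecMembership
open import Data.List.Membership.Propositional.Properties using (∈-map⁻; ∈-filter⁻)
import Data.List.Relation.Unary.All as All
open import Data.List.Relation.Unary.AllPairs using ([]; _∷_)
open import Data.List.Relation.Unary.Any using (here; there)
open import Data.List.Relation.Unary.Unique.Propositional using (Unique)
import Data.List.Relation.Unary.Unique.Propositional.Properties as Unique
open import Data.Nat.Base using (ℕ; nonZero; zero; suc; _+_; _*_; _^_; _≤_; _<_; z≤n; s≤s)
open import Data.Nat.Properties hiding (_≟_)
open import Data.Product.Base using (∃; ∃₂; _×_; _,_; proj₂; uncurry)
open import Data.Sum.Base using (_⊎_; inj₁; inj₂; [_,_]′)
open import Data.Unit.Base using (tt)
open import Data.Vec.Base as Vec using (Vec; []; _∷_; replicate; zipWith)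
import Data.Vec.Properties as Vec
open import Function.Base using (_∘_; id)
open import Relation.Binary.PropositionalEquality
open import Relation.Nullary.Decidable using (Dec; yes; no; does; ¬?; _×-dec_; _⊎-dec_; map′; dec-true; decidable-stable; from-no)
open import Relation.Nullary.Negation using (¬_; contradiction)
open import Relation.Unary using (Decidable)
open import Algebra.Properties.CommutativeSemigroup +-commutativeSemigroup using (interchange)

-- Binary vectors

Bits : ℕ → Set
Bits = Vec Bool

infixl 6 _⊞_
_⊞_ : ∀ {n} → Bits n → Bits n → Bits n
_⊞_ = zipWith _xor_

𝟎 : ∀ {n} → Bits n
𝟎 = replicate _ false

infix 4 _≟_
_≟_ : ∀ {n} (x y : Bits n) → Dec (x ≡ y)
_≟_ = Vec.≡-dec _≟ᴮ_

⊞-assoc : ∀ {n} (x y z : Bits n) → (x ⊞ y) ⊞ z ≡ x ⊞ (y ⊞ z)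
⊞-assoc = Vec.zipWith-assoc xor-assoc

⊞-comm : ∀ {n} (x y : Bits n) → x ⊞ y ≡ y ⊞ x
⊞-comm = Vec.zipWith-comm xor-comm

⊞-identityˡ : ∀ {n} (x : Bits n) → 𝟎 ⊞ x ≡ x
⊞-identityˡ = Vec.zipWith-identityˡ xor-identityˡ

⊞-identityʳ : ∀ {n} (x : Bits n) → x ⊞ 𝟎 ≡ x
⊞-identityʳ x = trans (⊞-comm x 𝟎) (⊞-identityˡ x)

⊞-self : ∀ {n} (x : Bits n) → x ⊞ x ≡ 𝟎
⊞-self []      = refl
⊞-self (b ∷ x) = cong₂ _∷_ (xor-same b) (⊞-self x)

⊞-cancelˡ : ∀ {n} (x y : Bits n) → x ⊞ (x ⊞ y) ≡ y
⊞-cancelˡ x y = begin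
  x ⊞ (x ⊞ y)  ≡⟨ ⊞-assoc x x y ⟨
  (x ⊞ x) ⊞ y  ≡⟨ cong (_⊞ y) (⊞-self x) ⟩
  𝟎 ⊞ y        ≡⟨ ⊞-identityˡ y ⟩
  y            ∎
  where open ≡-Reasoning

⊞-cancelʳ : ∀ {n} (x y : Bits n) → (x ⊞ y) ⊞ y ≡ x
⊞-cancelʳ x y = trans (⊞-comm (x ⊞ y) y) (trans (cong (y ⊞_) (⊞-comm x y)) (⊞-cancelˡ y x))

⊞≡𝟎⇒≡ : ∀ {n} {x y : Bits n} → x ⊞ y ≡ 𝟎 → x ≡ y
⊞≡𝟎⇒≡ {x = x} {y} eq = trans (sym (⊞-identityʳ x)) (trans (cong (x ⊞_) (sym eq)) (⊞-cancelˡ x y))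

x≡x⊞y⇒y≡𝟎 : ∀ {n} {x y : Bits n} → x ≡ x ⊞ y → y ≡ 𝟎
x≡x⊞y⇒y≡𝟎 {x = x} {y} eq = trans (sym (⊞-cancelˡ x y)) (trans (cong (x ⊞_) (sym eq)) (⊞-self x))

⊞-interchange : ∀ {n} (a b c d : Bits n) → (a ⊞ b) ⊞ (c ⊞ d) ≡ (a ⊞ c) ⊞ (b ⊞ d)
⊞-interchange a b c d = begin
  (a ⊞ b) ⊞ (c ⊞ d)  ≡⟨ ⊞-assoc a b (c ⊞ d) ⟩
  a ⊞ (b ⊞ (c ⊞ d))  ≡⟨ cong (a ⊞_) (⊞-assoc b c d) ⟨
  a ⊞ ((b ⊞ c) ⊞ d)  ≡⟨ cong (λ z → a ⊞ (z ⊞ d)) (⊞-comm b c) ⟩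
  a ⊞ ((c ⊞ b) ⊞ d)  ≡⟨ cong (a ⊞_) (⊞-assoc c b d) ⟩
  a ⊞ (c ⊞ (b ⊞ d))  ≡⟨ ⊞-assoc a c (b ⊞ d) ⟨
  (a ⊞ c) ⊞ (b ⊞ d)  ∎
  where open ≡-Reasoning

-- Exhaustive search; the finite checks below evaluate it on closed terms and extract the result
-- with `from-no`.
∃? : ∀ n {P : Bits n → Set} → Decidable P → Dec (∃ P)
∃? zero    P? = map′ ([] ,_) (λ { ([] , p) → p }) (P? [])
∃? (suc n) P? = map′
  (λ { (inj₁ (x , p)) → false ∷ x , p ; (inj₂ (x , p)) → true ∷ x , p })
  (λ { (false ∷ x , p) → inj₁ (x , p) ; (true ∷ x , p) → inj₂ (x , p) })
  (∃? n (P? ∘ (false ∷_)) ⊎-dec ∃? n (P? ∘ (true ∷_)))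

-- Sums over binary vectors

∑ : ∀ n → (Bits n → ℕ) → ℕ
∑ zero    f = f []
∑ (suc n) f = ∑ n (f ∘ (false ∷_)) + ∑ n (f ∘ (true ∷_))

∑-mono : ∀ n {f g : Bits n → ℕ} → (∀ x → f x ≤ g x) → ∑ n f ≤ ∑ n g
∑-mono zero    f≤g = f≤g []
∑-mono (suc n) f≤g = +-mono-≤ (∑-mono n (f≤g ∘ (false ∷_))) (∑-mono n (f≤g ∘ (true ∷_)))

∑-cong : ∀ n {f g : Bits n → ℕ} → (∀ x → f x ≡ g x) → ∑ n f ≡ ∑ n g
∑-cong zero    f≡g = f≡g []
∑-cong (suc n) f≡g = cong₂ _+_ (∑-cong n (f≡g ∘ (false ∷_))) (∑-cong n (f≡g ∘ (true ∷_)))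

∑-+ : ∀ n (f g : Bits n → ℕ) → ∑ n (λ x → f x + g x) ≡ ∑ n f + ∑ n g
∑-+ zero    f g = refl
∑-+ (suc n) f g = trans
  (cong₂ _+_ (∑-+ n (f ∘ (false ∷_)) (g ∘ (false ∷_))) (∑-+ n (f ∘ (true ∷_)) (g ∘ (true ∷_))))
  (interchange (∑ n (f ∘ (false ∷_))) (∑ n (g ∘ (false ∷_))) (∑ n (f ∘ (true ∷_))) (∑ n (g ∘ (true ∷_))))

∑-const : ∀ n c → ∑ n (λ _ → c) ≡ 2 ^ n * c
∑-const zero    c = sym (+-identityʳ c)
∑-const (suc n) c = begin
  ∑ n (λ _ → c) + ∑ n (λ _ → c)  ≡⟨ cong₂ _+_ (∑-const n c) (∑-const n c) ⟩
  2 ^ n * c + 2 ^ n * c          ≡⟨ *-distribʳ-+ c (2 ^ n) (2 ^ n) ⟨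
  (2 ^ n + 2 ^ n) * c            ≡⟨ cong (λ m → (2 ^ n + m) * c) (+-identityʳ (2 ^ n)) ⟨
  2 ^ suc n * c                  ∎
  where open ≡-Reasoning

∑-shift : ∀ n (k : Bits n) (f : Bits n → ℕ) → ∑ n (λ x → f (k ⊞ x)) ≡ ∑ n f
∑-shift zero    []          f = refl
∑-shift (suc n) (false ∷ k) f = cong₂ _+_ (∑-shift n k (f ∘ (false ∷_))) (∑-shift n k (f ∘ (true ∷_)))
∑-shift (suc n) (true ∷ k)  f = trans
  (cong₂ _+_ (∑-shift n k (f ∘ (true ∷_))) (∑-shift n k (f ∘ (false ∷_))))
  (+-comm (∑ n (f ∘ (true ∷_))) (∑ n (f ∘ (false ∷_))))

≤-∑ : ∀ {n} (f : Bits n → ℕ) x → f x ≤ ∑ n f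
≤-∑ f []          = ≤-refl
≤-∑ f (false ∷ x) = ≤-trans (≤-∑ (f ∘ (false ∷_)) x) (m≤m+n _ _)
≤-∑ f (true ∷ x)  = ≤-trans (≤-∑ (f ∘ (true ∷_)) x) (m≤n+m _ _)

-- Records an excess or a deficit at the single point `a`, so that a bound that differs there can
-- still be summed.
spike : ∀ {n} → Bits n → ℕ → Bits n → ℕ
spike a k x = if does (x ≟ a) then k else 0

∑-0 : ∀ n → ∑ n (λ _ → 0) ≡ 0
∑-0 n = trans (∑-const n 0) (*-zeroʳ (2 ^ n))

∑-spike : ∀ {n} (a : Bits n) k → ∑ n (spike a k) ≡ k
∑-spike []                  k = refl
∑-spike {suc n} (false ∷ a) k = trans (cong₂ _+_ (∑-spike a k) (∑-0 n)) (+-identityʳ k)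
∑-spike {suc n} (true ∷ a)  k = cong₂ _+_ (∑-0 n) (∑-spike a k)

-- Subsets of (ℤ/2)ⁿ and the differences they avoid

χ : Bool → ℕ
χ b = if b then 1 else 0

χ≤1 : ∀ b → χ b ≤ 1
χ≤1 true  = s≤s z≤n
χ≤1 false = z≤n

card : ∀ {n} → (Bits n → Bool) → ℕ
card {n} f = ∑ n (χ ∘ f)

HasDiff : ∀ {n} → (Bits n → Bool) → Bits n → Set
HasDiff f δ = ∃ λ b → T (f b) × T (f (b ⊞ δ))

hasDiff? : ∀ {n} (f : Bits n → Bool) → Decidable (HasDiff f)
hasDiff? {n} f δ = ∃? n λ b → T? (f b) ×-dec T? (f (b ⊞ δ))

card-shift : ∀ {n} (k : Bits n) (f : Bits n → Bool) → ∑ n (λ x → χ (f (x ⊞ k))) ≡ card f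
card-shift {n} k f = trans (∑-cong n (λ x → cong (χ ∘ f) (⊞-comm x k))) (∑-shift n k (χ ∘ f))

exclusive : ∀ {n} (f : Bits n → Bool) {δ} → ¬ HasDiff f δ → ∀ x {y} → x ⊞ δ ≡ y → T (f x) → ¬ T (f y)
exclusive f ¬d x refl fx fy = ¬d (x , fx , fy)

χ-exclusive₂ : ∀ a b → (T a → ¬ T b) → χ a + χ b ≤ 1
χ-exclusive₂ true  true  h = ⊥-elim (h tt tt)
χ-exclusive₂ true  false h = ≤-refl
χ-exclusive₂ false b     h = χ≤1 b

χ-exclusive₄ : ∀ a b c d → (T a → ¬ T b) → (T a → ¬ T c) → (T a → ¬ T d) →
               (T b → ¬ T c) → (T b → ¬ T d) → (T c → ¬ T d) → (χ a + χ b) + (χ c + χ d) ≤ 1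
χ-exclusive₄ false false c     d     _  _  _  _  _  cd = χ-exclusive₂ c d cd
χ-exclusive₄ true  true  c     d     ab _  _  _  _  _  = ⊥-elim (ab tt tt)
χ-exclusive₄ true  false true  d     _  ac _  _  _  _  = ⊥-elim (ac tt tt)
χ-exclusive₄ true  false false true  _  _  ad _  _  _  = ⊥-elim (ad tt tt)
χ-exclusive₄ true  false false false _  _  _  _  _  _  = ≤-refl
χ-exclusive₄ false true  true  d     _  _  _  bc _  _  = ⊥-elim (bc tt tt)
χ-exclusive₄ false true  false true  _  _  _  _  bd _  = ⊥-elim (bd tt tt)
χ-exclusive₄ false true  false false _  _  _  _  _  _  = ≤-refl

-- The set and its translate by `δ` are disjoint.
packing₂ : ∀ {n} (f : Bits n → Bool) {δ} → ¬ HasDiff f δ → card f + card f ≤ 2 ^ n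
packing₂ {n} f {δ} ¬d = begin
  card f + card f                        ≡⟨ cong (card f +_) (card-shift δ f) ⟨
  card f + ∑ n (λ x → χ (f (x ⊞ δ)))     ≡⟨ ∑-+ n (χ ∘ f) (λ x → χ (f (x ⊞ δ))) ⟨
  ∑ n (λ x → χ (f x) + χ (f (x ⊞ δ)))    ≤⟨ ∑-mono n (λ x → χ-exclusive₂ _ _ (exclusive f ¬d x refl)) ⟩
  ∑ n (λ _ → 1)                          ≡⟨ trans (∑-const n 1) (*-identityʳ (2 ^ n)) ⟩
  2 ^ n                                  ∎
  where open ≤-Reasoning

-- The translates by `𝟎`, `u`, `v` and `u ⊞ v` are pairwise disjoint, since any two of these shifts
-- differ by `u`, `v` or `u ⊞ v`.
packing₄ : ∀ {n} (f : Bits n → Bool) {u v} → ¬ HasDiff f u → ¬ HasDiff f v → ¬ HasDiff f (u ⊞ v) →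
           (card f + card f) + (card f + card f) ≤ 2 ^ n
packing₄ {n} f {u} {v} ¬u ¬v ¬uv = begin
  (card f + card f) + (card f + card f)
    ≡⟨ cong₂ _+_ (cong (card f +_) (card-shift u f)) (cong₂ _+_ (card-shift v f) (card-shift (u ⊞ v) f)) ⟨
  (∑ n f₀ + ∑ n f₁) + (∑ n f₂ + ∑ n f₃)
    ≡⟨ cong₂ _+_ (∑-+ n f₀ f₁) (∑-+ n f₂ f₃) ⟨
  ∑ n (λ x → f₀ x + f₁ x) + ∑ n (λ x → f₂ x + f₃ x)
    ≡⟨ ∑-+ n (λ x → f₀ x + f₁ x) (λ x → f₂ x + f₃ x) ⟨
  ∑ n (λ x → (f₀ x + f₁ x) + (f₂ x + f₃ x))
    ≤⟨ ∑-mono n atMostOne ⟩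
  ∑ n (λ _ → 1)
    ≡⟨ trans (∑-const n 1) (*-identityʳ (2 ^ n)) ⟩
  2 ^ n ∎
  where
  open ≤-Reasoning
  f₀ f₁ f₂ f₃ : Bits n → ℕ
  f₀ x = χ (f x)
  f₁ x = χ (f (x ⊞ u))
  f₂ x = χ (f (x ⊞ v))
  f₃ x = χ (f (x ⊞ (u ⊞ v)))
  atMostOne : ∀ x → (f₀ x + f₁ x) + (f₂ x + f₃ x) ≤ 1
  atMostOne x = χ-exclusive₄ _ _ _ _
    (exclusive f ¬u x refl) (exclusive f ¬v x refl) (exclusive f ¬uv x refl)
    (exclusive f ¬uv (x ⊞ u) (trans (⊞-assoc x u (u ⊞ v)) (cong (x ⊞_) (⊞-cancelˡ u v))))
    (exclusive f ¬v (x ⊞ u) (⊞-assoc x u v))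
    (exclusive f ¬u (x ⊞ v) (trans (⊞-assoc x v u) (cong (x ⊞_) (⊞-comm v u))))

-- Families of subsets indexed by the residues mod 2

-- Progression-freeness in terms of fibres; `fibres-separated` and `elements-free` are the two
-- directions.
Separated : ∀ {n} → (Bits n → Bits n → Bool) → Set
Separated F = ∀ a δ → δ ≢ 𝟎 → HasDiff (F a) δ → ¬ HasDiff (F (a ⊞ δ)) δ

total : ∀ {n} → (Bits n → Bits n → Bool) → ℕ
total {n} F = ∑ n (card ∘ F)

card≤ : ∀ {m} (f : Bits (suc m) → Bool) {δ} → ¬ HasDiff f δ → card f ≤ 2 ^ m
card≤ {m} f ¬d = *-cancelˡ-≤ 2 (subst (_≤ 2 ^ suc m) (cong (card f +_) (sym (+-identityʳ (card f)))) (packing₂ f ¬d))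

large⇒hasDiff : ∀ {m} (f : Bits (suc m) → Bool) → 2 ^ m < card f → ∀ δ → HasDiff f δ
large⇒hasDiff f large δ with hasDiff? f δ
... | yes d = d
... | no ¬d = contradiction large (≤⇒≯ (card≤ f ¬d))

module _ {m : ℕ} {F : Bits (suc m) → Bits (suc m) → Bool} (sep : Separated F) where

  -- `F a` has the difference `a ⊞ b`, so `F b` avoids it and is at most half of the space.
  large⇒card≤ : ∀ {a} → 2 ^ m < card (F a) → ∀ b → b ≢ a → card (F b) ≤ 2 ^ m
  large⇒card≤ {a} large b b≢a = card≤ (F b) λ d →
    sep a (a ⊞ b) (b≢a ∘ sym ∘ ⊞≡𝟎⇒≡) (large⇒hasDiff (F a) large (a ⊞ b))
      (subst (λ c → HasDiff (F c) (a ⊞ b)) (sym (⊞-cancelˡ a b)) d)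

  total≤ : total F ≤ 2 ^ suc m * 2 ^ m + 2 ^ m
  total≤ with ∃? (suc m) (λ a → 2 ^ m <? card (F a))
  ... | no none = ≤-trans
    (≤-trans (∑-mono (suc m) (λ b → ≮⇒≥ (none ∘ (b ,_)))) (≤-reflexive (∑-const (suc m) (2 ^ m))))
    (m≤m+n _ _)
  ... | yes (a , large) = begin
    -- Only the fibre over `a` can exceed `2 ^ m`; the spike pays for its excess of at most `2 ^ m`.
    total F                                          ≤⟨ ∑-mono (suc m) bound ⟩
    ∑ (suc m) (λ b → 2 ^ m + spike a (2 ^ m) b)      ≡⟨ ∑-+ (suc m) (λ _ → 2 ^ m) (spike a (2 ^ m)) ⟩
    ∑ (suc m) (λ _ → 2 ^ m) + ∑ (suc m) (spike a (2 ^ m))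
                                                     ≡⟨ cong₂ _+_ (∑-const (suc m) (2 ^ m)) (∑-spike a (2 ^ m)) ⟩
    2 ^ suc m * 2 ^ m + 2 ^ m                        ∎
    where
    open ≤-Reasoning
    card≤2^n : ∀ b → card (F b) ≤ 2 ^ m + 2 ^ m
    card≤2^n b = begin
      card (F b)              ≤⟨ ∑-mono (suc m) (λ x → χ≤1 (F b x)) ⟩
      ∑ (suc m) (λ _ → 1)     ≡⟨ trans (∑-const (suc m) 1) (*-identityʳ (2 ^ suc m)) ⟩
      2 ^ m + (2 ^ m + 0)     ≡⟨ cong (2 ^ m +_) (+-identityʳ (2 ^ m)) ⟩
      2 ^ m + 2 ^ m           ∎
    bound : ∀ b → card (F b) ≤ 2 ^ m + spike a (2 ^ m) b
    bound b with b ≟ a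
    ... | yes _  = card≤2^n b
    ... | no b≢a = ≤-trans (large⇒card≤ large b b≢a) (m≤m+n _ _)

-- Linear maps

-- The linear map that sends the unit vectors to the entries of the given list.
lin : ∀ {m n} → Vec (Bits n) m → Bits m → Bits n
lin []       []      = 𝟎
lin (v ∷ vs) (b ∷ x) = (if b then v else 𝟎) ⊞ lin vs x

lin-⊞ : ∀ {m n} (vs : Vec (Bits n) m) x y → lin vs (x ⊞ y) ≡ lin vs x ⊞ lin vs y
lin-⊞ []       []      []      = sym (⊞-self 𝟎)
lin-⊞ (v ∷ vs) (b ∷ x) (c ∷ y) = trans
  (cong₂ _⊞_ (scalar b c) (lin-⊞ vs x y))
  (⊞-interchange (if b then v else 𝟎) (if c then v else 𝟎) (lin vs x) (lin vs y))
  where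
  scalar : ∀ b c → (if b xor c then v else 𝟎) ≡ (if b then v else 𝟎) ⊞ (if c then v else 𝟎)
  scalar true  true  = sym (⊞-self v)
  scalar true  false = sym (⊞-identityʳ v)
  scalar false c     = sym (⊞-identityˡ _)

Independent : ∀ {m n} → Vec (Bits n) m → Set
Independent vs = ∀ x → x ≢ 𝟎 → lin vs x ≢ 𝟎

kernel? : ∀ {m n} (vs : Vec (Bits n) m) → Dec (∃ λ x → x ≢ 𝟎 × lin vs x ≡ 𝟎)
kernel? {m} vs = ∃? m λ x → ¬? (x ≟ 𝟎) ×-dec (lin vs x ≟ 𝟎)

independent : ∀ {m n} (vs : Vec (Bits n) m) → ¬ (∃ λ x → x ≢ 𝟎 × lin vs x ≡ 𝟎) → Independent vs
independent vs ¬∃ x x≢𝟎 eq = ¬∃ (x , x≢𝟎 , eq)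

lin-injective : ∀ {m n} (vs : Vec (Bits n) m) → Independent vs → ∀ {x y} → x ≢ y → lin vs x ≢ lin vs y
lin-injective vs ind {x} {y} x≢y eq = ind (x ⊞ y) (x≢y ∘ ⊞≡𝟎⇒≡)
  (trans (lin-⊞ vs x y) (trans (cong (_⊞ lin vs y) eq) (⊞-self (lin vs y))))

-- The contradiction in (ℤ/2)⁴

-- e b x stands for "the fibre over b avoids the difference x".
record Config {n} (s : Bits n) (e : Bits n → Bits n → Set) : Set where
  field
    self    : ∀ {b} → b ≢ 𝟎 → e b b
    sumFree : ∀ {b u v} → b ≢ 𝟎 → b ≢ s → u ≢ 𝟎 → v ≢ 𝟎 → u ≢ v → e b u → e b v → ¬ e b (u ⊞ v)
    cover   : ∀ {b c} → b ≢ c → e b (b ⊞ c) ⊎ e c (b ⊞ c)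

-- The axioms mention only sums, `𝟎` and the exceptional point, so they pull back along injective
-- linear maps. This permits a change of basis.
transport : ∀ {m n s t} {e : Bits n → Bits n → Set} (vs : Vec (Bits n) m) → Independent vs → lin vs t ≡ s →
            Config s e → Config t (λ b x → e (lin vs b) (lin vs x))
transport {e = e} vs ind refl C = record
  { self    = λ b≢𝟎 → self (ind _ b≢𝟎)
  ; sumFree = λ {b} {u} {v} b≢𝟎 b≢s u≢𝟎 v≢𝟎 u≢v eu ev euv →
      sumFree (ind _ b≢𝟎) (lin-injective vs ind b≢s) (ind _ u≢𝟎) (ind _ v≢𝟎) (lin-injective vs ind u≢v) eu ev
        (subst (e (lin vs b)) (lin-⊞ vs u v) euv)
  ; cover   = λ {b} {c} b≢c →
      subst (λ x → e (lin vs b) x ⊎ e (lin vs c) x) (sym (lin-⊞ vs b c)) (cover (lin-injective vs ind b≢c))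
  }
  where open Config C

s p q r : Bits 4
s = true ∷ false ∷ false ∷ false ∷ []
p = false ∷ true ∷ false ∷ false ∷ []
q = false ∷ false ∷ true ∷ false ∷ []
r = false ∷ false ∷ false ∷ true ∷ []

-- Boolean-valued, so that at concrete points `T (good x)` reduces to the unit type and is filled in
-- as an implicit argument.
good : Bits 4 → Bool
good x = not (does (x ≟ 𝟎)) ∧ not (does (x ≟ s))

good⇒≢𝟎 : ∀ x → T (good x) → x ≢ 𝟎
good⇒≢𝟎 x g refl = g

good⇒≢s : ∀ x → T (good x) → x ≢ s
good⇒≢s x g refl = g

nonzero : Bits 4 → Bool
nonzero x = not (does (x ≟ 𝟎))

nonzero⇒≢𝟎 : ∀ x → T (nonzero x) → x ≢ 𝟎
nonzero⇒≢𝟎 x nz refl = nz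

module Orientation {e : Bits 4 → Bits 4 → Set} (C : Config s e) where
  open Config C

  sum : ∀ b u v {_ : T (good b)} {_ : T (nonzero u)} {_ : T (nonzero v)} {_ : T (nonzero (u ⊞ v))} →
        e b u → e b v → ¬ e b (u ⊞ v)
  sum b u v {gb} {nu} {nv} {nuv} = sumFree (good⇒≢𝟎 b gb) (good⇒≢s b gb) (nonzero⇒≢𝟎 u nu) (nonzero⇒≢𝟎 v nv)
    (λ { refl → nonzero⇒≢𝟎 (u ⊞ u) nuv (⊞-self u) })

  -- A line of PG(3,2) that misses `s`, with its three points in a chosen order.
  record Line (x y z : Bits 4) : Set where
    constructor mkLine
    field
      x⊞y≡z : x ⊞ y ≡ z
      good₁ : T (good x)
      good₂ : T (good y)
      good₃ : T (good z)

  rotate : ∀ {x y z} → Line x y z → Line y z x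
  rotate {x} {y} (mkLine refl gx gy gz) = mkLine (trans (⊞-comm y (x ⊞ y)) (⊞-cancelʳ x y)) gy gz gx

  swap : ∀ {x y z} → Line x y z → Line y x z
  swap {x} {y} (mkLine refl gx gy gz) = mkLine (⊞-comm y x) gy gx gz

  distinct : ∀ {x y z} → Line x y z → x ≢ y
  distinct {x} (mkLine refl gx gy gz) refl = good⇒≢𝟎 (x ⊞ x) gz (⊞-self x)

  -- By `self`, `e x x` holds; together with `e x y`, `sumFree` rules out the sum `x ⊞ y`, which is
  -- `z`.
  excludes : ∀ {x y z} → Line x y z → e x y → ¬ e x z
  excludes {x} l@(mkLine refl gx gy gz) =
    sumFree x≢𝟎 (good⇒≢s x gx) x≢𝟎 (good⇒≢𝟎 _ gy) (distinct l) (self x≢𝟎)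
    where x≢𝟎 = good⇒≢𝟎 x gx

  -- On a line of good points, e is one of the two cyclic orientations
  -- x → y → z → x and x → z → y → x.
  next : ∀ {x y z} → Line x y z → e x y → e y z
  next {x} {y} l@(mkLine refl gx gy gz) xy with cover (distinct l)
  ... | inj₁ xz = contradiction xz (excludes l xy)
  ... | inj₂ yz = yz

  -- `cover` gives an arrow from `x` or `y` to `z`; following the cycle for two more arrows leads to
  -- one between `x` and `y`.
  connex : ∀ {x y z} → Line x y z → e x y ⊎ e y x
  connex {x} {y} l@(mkLine refl gx gy gz) with cover (distinct l)
  ... | inj₁ xz = inj₂ (next (swap (rotate l)) (next (swap (rotate (rotate l))) xz))
  ... | inj₂ yz = inj₁ (next (rotate (rotate l)) (next (rotate l) yz))

  line : ∀ x y {_ : T (good x)} {_ : T (good y)} {_ : T (good (x ⊞ y))} → Line x y (x ⊞ y)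
  line x y {gx} {gy} {gz} = mkLine refl gx gy gz

  turn : ∀ x y {_ : T (good x)} {_ : T (good y)} {_ : T (good (x ⊞ y))} → e x y → e y (x ⊞ y)
  turn x y {gx} {gy} {gz} = next (line x y {gx} {gy} {gz})

  reverse : ∀ x y {_ : T (good x)} {_ : T (good y)} {_ : T (good (x ⊞ y))} → ¬ e x y → e y x
  reverse x y {gx} {gy} {gz} ¬xy = [ ⊥-elim ∘ ¬xy , id ]′ (connex (line x y {gx} {gy} {gz}))

  compare : ∀ x y {_ : T (good x)} {_ : T (good y)} {_ : T (good (x ⊞ y))} → e x y ⊎ e y x
  compare x y {gx} {gy} {gz} = connex (line x y {gx} {gy} {gz})

  -- The dual of `sum` for arrows into `b`: `turn` makes them arrows from `b` to `u ⊞ b` and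
  -- `v ⊞ b`.
  cosum : ∀ b u v {_ : T (good b)} {_ : T (good u)} {_ : T (good v)} {_ : T (good (u ⊞ b))} {_ : T (good (v ⊞ b))}
          {_ : T (nonzero ((u ⊞ b) ⊞ (v ⊞ b)))} → e u b → e v b → ¬ e b ((u ⊞ b) ⊞ (v ⊞ b))
  cosum b u v {gb} {gu} {gv} {gub} {gvb} {nz} ub vb =
    sumFree (good⇒≢𝟎 b gb) (good⇒≢s b gb) (good⇒≢𝟎 _ gub) (good⇒≢𝟎 _ gvb)
      (λ eq → nonzero⇒≢𝟎 _ nz (trans (cong (_⊞ (v ⊞ b)) eq) (⊞-self (v ⊞ b))))
      (turn u b {gu} {gb} {gub} ub) (turn v b {gv} {gb} {gvb} vb)

-- Parity on the nine pairs of {p, r, p + r} × {p + s, p + q, q + s}: by sum and cosum, an even number of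
-- the e x y with y on a line missing x hold; the pair (p, p + s), whose line contains s, is the exception.
module _ {e : Bits 4 → Bits 4 → Set} (C : Config s e) where
  open Config C
  open Orientation C

  private
    t q₀ q₁ q₂ : Bits 4
    t  = p ⊞ r
    q₀ = p ⊞ s
    q₁ = p ⊞ q
    q₂ = q ⊞ s

  oriented-clash : e p q → e p q₂ → e q₁ r → ⊥
  oriented-clash pq pq₂ q₁r = [ case₁ , case₂ ]′ (compare q₀ r)
    where
    q₁p : e q₁ p
    q₁p = turn q q₁ (turn p q pq)
    tq₁ : e t q₁
    tq₁ = reverse q₁ t (sum q₁ p r q₁p q₁r)
    ¬ps : ¬ e p s
    ¬ps = sum p q q₂ pq pq₂
    q₀s : e q₀ s
    q₀s = [ ⊥-elim ∘ ¬ps , id ]′ (cover {p} {q₀} λ ())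
    case₁ : e q₀ r → ⊥
    case₁ q₀r = sum-t (reverse t q₂ λ tq₂ → cosum q₂ p t pq₂ tq₂ q₂r)
      where
      -- An arrow from `t` to `q₀` would turn into one from `q₀` to `t ⊞ q₀`, which is `s ⊞ r`.
      q₀t : e q₀ t
      q₀t = reverse t q₀ λ tq₀ → sum q₀ s r q₀s q₀r (turn t q₀ tq₀)
      -- Here `cosum` excludes `(q₀ ⊞ r) ⊞ (q₁ ⊞ r)`, which is `q₂`.
      q₂r : e q₂ r
      q₂r = reverse r q₂ (cosum r q₀ q₁ q₀r q₁r)
      sum-t : ¬ e q₂ t
      sum-t q₂t = cosum t q₀ q₂ q₀t q₂t tq₁
    case₂ : e r q₀ → ⊥
    case₂ rq₀ = sum t q₀ q₂ tq₀ tq₂ tq₁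
      where
      tq₀ : e t q₀
      tq₀ = reverse q₀ t λ q₀t → sum q₀ s t q₀s q₀t (turn r q₀ rq₀)
      rq₂ : e r q₂
      rq₂ = reverse q₂ r λ q₂r → cosum r q₁ q₂ q₁r q₂r rq₀
      tq₂ : e t q₂
      tq₂ = reverse q₂ t (cosum q₂ p r pq₂ rq₂)

module _ {e : Bits 4 → Bits 4 → Set} (C : Config s e) where
  open Config C
  open Orientation C

  -- Since `e (p ⊞ q) p` holds, `cosum` shows that `r` and `p ⊞ r` cannot both have an arrow to
  -- `p ⊞ q`. So replacing `r` by `p ⊞ r` if necessary gives the orientation that `oriented-clash`
  -- needs.
  clash : e p q → e p (q ⊞ s) → ⊥
  clash pq pq₂ with compare (p ⊞ q) r
  ... | inj₁ q₁r = oriented-clash C pq pq₂ q₁r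
  ... | inj₂ rq₁ = oriented-clash (transport basis (independent basis (from-no (kernel? basis))) refl C) pq pq₂
    (reverse (p ⊞ r) (p ⊞ q) λ tq₁ → cosum (p ⊞ q) r (p ⊞ r) rq₁ tq₁ (turn q (p ⊞ q) (turn p q pq)))
    where
    basis : Vec (Bits 4) 4
    basis = s ∷ p ∷ q ∷ p ⊞ r ∷ []

-- Three lines that miss `s` in the plane of `p`, `q`, `s` are compared. They meet pairwise in `p`,
-- `q` and `p ⊞ q ⊞ s`, and have the same image modulo `s`, so that their orientations can be said
-- to agree.
noConfig : ∀ {e : Bits 4 → Bits 4 → Set} → ¬ Config s e
noConfig {e} C =
  [ (λ pq → [ clash₁ pq , (λ q₂p → [ clash₂ pq , clash₃ q₂p ]′ l₃) ]′ l₂)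
  , (λ qp → [ (λ pq₂ → [ clash₄ pq₂ , clash₅ qp ]′ l₃) , clash₆ qp ]′ l₂)
  ]′ l₁
  where
  open Orientation C
  -- Of three orientations two agree, which yields e v y and e v (y ⊞ s) at the common point v of two lines.
  l₁ = compare p q
  l₂ = compare p (q ⊞ s)
  l₃ = compare (p ⊞ s) q
  basis : Bits 4 → Bits 4 → Vec (Bits 4) 4
  basis v y = s ∷ v ∷ y ∷ r ∷ []
  at : ∀ v y → ¬ (∃ λ x → x ≢ 𝟎 × lin (basis v y) x ≡ 𝟎) → lin (basis v y) s ≡ s →
       Config s (λ b x → e (lin (basis v y) b) (lin (basis v y) x))
  at v y ind eq = transport (basis v y) (independent (basis v y) ind) eq C
  clash₁ : e p q → e p (q ⊞ s) → ⊥
  clash₁ = clash C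
  clash₂ : e p q → e (p ⊞ s) q → ⊥
  clash₂ pq h = clash (at q (p ⊞ q) (from-no (kernel? (basis q (p ⊞ q)))) refl) (turn p q pq) (turn (p ⊞ s) q h)
  clash₃ : e (q ⊞ s) p → e q (p ⊞ s) → ⊥
  clash₃ h h′ = clash (at (p ⊞ q ⊞ s) q (from-no (kernel? (basis (p ⊞ q ⊞ s) q))) refl)
    (turn (p ⊞ s) (p ⊞ q ⊞ s) (turn q (p ⊞ s) h′)) (turn p (p ⊞ q ⊞ s) (turn (q ⊞ s) p h))
  clash₄ : e p (q ⊞ s) → e (p ⊞ s) q → ⊥
  clash₄ h h′ = clash (at (p ⊞ q ⊞ s) p (from-no (kernel? (basis (p ⊞ q ⊞ s) p))) refl)
    (turn (q ⊞ s) (p ⊞ q ⊞ s) (turn p (q ⊞ s) h)) (turn q (p ⊞ q ⊞ s) (turn (p ⊞ s) q h′))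
  clash₅ : e q p → e q (p ⊞ s) → ⊥
  clash₅ = clash (at q p (from-no (kernel? (basis q p))) refl)
  clash₆ : e q p → e (q ⊞ s) p → ⊥
  clash₆ h h′ = clash (at p (p ⊞ q) (from-no (kernel? (basis p (p ⊞ q)))) refl) (turn q p h) (turn (q ⊞ s) p h′)
-- The bound for n = 4

-- A basis whose first vector, the image of `s`, is `b`; the unit vector at the first nonzero
-- coordinate of `b` is dropped.
complete : Bits 4 → Vec (Bits 4) 4
complete b@(true ∷ _)                 = b ∷ p ∷ q ∷ r ∷ []
complete b@(false ∷ true ∷ _)         = b ∷ s ∷ q ∷ r ∷ []
complete b@(false ∷ false ∷ true ∷ _) = b ∷ s ∷ p ∷ r ∷ []
complete b                            = b ∷ s ∷ p ∷ q ∷ []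

complete-independent : ∀ {b} → b ≢ 𝟎 → Independent (complete b)
complete-independent {b} b≢𝟎 = independent (complete b) λ dep →
  from-no (∃? 4 λ b → ¬? (b ≟ 𝟎) ×-dec kernel? (complete b)) (b , b≢𝟎 , dep)

lin-complete-s : ∀ b → lin (complete b) s ≡ b
lin-complete-s (true ∷ b)                         = ⊞-identityʳ _
lin-complete-s (false ∷ true ∷ b)                 = ⊞-identityʳ _
lin-complete-s (false ∷ false ∷ true ∷ b)         = ⊞-identityʳ _
lin-complete-s (false ∷ false ∷ false ∷ b ∷ [])   = ⊞-identityʳ _

module _ {F : Bits 4 → Bits 4 → Bool} (sep : Separated F) (large : 8 < card (F 𝟎)) where

  -- `self` holds because `F 𝟎` has all differences, `sumFree` because four disjoint translates of
  -- more than 4 elements do not fit into 16 points, and `cover` by separation.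
  config : ∀ {b₀} → (∀ b → b ≢ 𝟎 → b ≢ b₀ → 4 < card (F b)) → Config b₀ (λ b x → ¬ HasDiff (F b) x)
  config many = record
    { self    = λ {b} b≢𝟎 → sep 𝟎 b b≢𝟎 (large⇒hasDiff (F 𝟎) large b) ∘ subst (λ a → HasDiff (F a) b) (sym (⊞-identityˡ b))
    ; sumFree = λ {b} b≢𝟎 b≢b₀ _ _ _ ¬u ¬v ¬uv → <⇒≱
        (+-mono-< (+-mono-< (many b b≢𝟎 b≢b₀) (many b b≢𝟎 b≢b₀)) (+-mono-< (many b b≢𝟎 b≢b₀) (many b b≢𝟎 b≢b₀)))
        (packing₄ (F b) ¬u ¬v ¬uv)
    ; cover   = covered
    }
    where
    covered : ∀ {b c} → b ≢ c → ¬ HasDiff (F b) (b ⊞ c) ⊎ ¬ HasDiff (F c) (b ⊞ c)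
    covered {b} {c} b≢c with hasDiff? (F b) (b ⊞ c)
    ... | no ¬d = inj₁ ¬d
    ... | yes d = inj₂ (sep b (b ⊞ c) (b≢c ∘ ⊞≡𝟎⇒≡) d ∘ subst (λ a → HasDiff (F a) (b ⊞ c)) (sym (⊞-cancelˡ b c)))

  Small : Bits 4 → Set
  Small b = b ≢ 𝟎 × card (F b) ≤ 4

  small? : Decidable Small
  small? b = ¬? (b ≟ 𝟎) ×-dec (card (F b) ≤? 4)

  -- Otherwise `config` applies with `b₀` exceptional, and a change of basis moves `b₀` to `s`.
  someSmall : ∀ b₀ → b₀ ≢ 𝟎 → ∃ λ b → b ≢ b₀ × Small b
  someSmall b₀ b₀≢𝟎 with ∃? 4 (λ b → ¬? (b ≟ b₀) ×-dec small? b)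
  ... | yes found = found
  ... | no none   = contradiction
    (transport (complete b₀) (complete-independent b₀≢𝟎) (lin-complete-s b₀)
      (config λ b b≢𝟎 b≢b₀ → ≰⇒> λ c≤4 → none (b , b≢b₀ , b≢𝟎 , c≤4)))
    noConfig

  large-total≤128 : total F ≤ 128
  -- Any nonzero point serves as a start; excluding the small fibre found first then yields a second
  -- one.
  large-total≤128 with someSmall s (λ ())
  ... | b₁ , _ , b₁≢𝟎 , small₁ with someSmall b₁ b₁≢𝟎
  -- The deficits of 4 at `b₁` and `b₂` balance the excess of 8 at `𝟎`. Adding them on the left
  -- avoids subtraction.
  ...   | b₂ , b₂≢b₁ , b₂≢𝟎 , small₂ = +-cancelʳ-≤ 8 (total F) 128 (begin
    total F + (4 + 4)
      ≡⟨ cong (total F +_) (cong₂ _+_ (∑-spike b₁ 4) (∑-spike b₂ 4)) ⟨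
    total F + (∑ 4 (spike b₁ 4) + ∑ 4 (spike b₂ 4))
      ≡⟨ cong (total F +_) (∑-+ 4 (spike b₁ 4) (spike b₂ 4)) ⟨
    total F + ∑ 4 (λ b → spike b₁ 4 b + spike b₂ 4 b)
      ≡⟨ ∑-+ 4 (card ∘ F) (λ b → spike b₁ 4 b + spike b₂ 4 b) ⟨
    ∑ 4 (λ b → card (F b) + (spike b₁ 4 b + spike b₂ 4 b))
      ≤⟨ ∑-mono 4 bound ⟩
    ∑ 4 (λ b → 8 + spike 𝟎 8 b)
      ≡⟨⟩
    128 + 8 ∎)
    where
    open ≤-Reasoning
    bound : ∀ b → card (F b) + (spike b₁ 4 b + spike b₂ 4 b) ≤ 8 + spike 𝟎 8 b
    bound b with b ≟ b₁ | b ≟ b₂ | b ≟ 𝟎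
    ... | yes refl | yes refl | _        = contradiction refl b₂≢b₁
    ... | yes refl | no _     | yes refl = contradiction refl b₁≢𝟎
    ... | yes refl | no _     | no _     = +-monoˡ-≤ 4 small₁
    ... | no _     | yes refl | yes refl = contradiction refl b₂≢𝟎
    ... | no _     | yes refl | no _     = +-monoˡ-≤ 4 small₂
    ... | no _     | no _     | yes refl = +-monoˡ-≤ 0 (∑-mono 4 (λ x → χ≤1 (F b x)))
    ... | no _     | no _     | no b≢𝟎   = +-monoˡ-≤ 0 (large⇒card≤ {F = F} sep large b b≢𝟎)

total≤128 : ∀ {F : Bits 4 → Bits 4 → Bool} → Separated F → total F ≤ 128
total≤128 {F} sep with ∃? 4 (λ a → 8 <? card (F a))
... | no none           = ∑-mono 4 (λ b → ≮⇒≥ (none ∘ (b ,_)))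
-- Translating the index by `a` moves the large fibre to `𝟎`.
... | yes (a , large) = subst (_≤ 128) (∑-shift 4 a (card ∘ F))
  (large-total≤128 {F = λ b → F (a ⊞ b)}
    (λ b δ δ≢𝟎 d → sep (a ⊞ b) δ δ≢𝟎 d ∘ subst (λ c → HasDiff (F c) δ) (sym (⊞-assoc a b δ)))
    (subst (λ c → 8 < card (F c)) (sym (⊞-identityʳ a)) large))

-- The encoding of (ℤ/4)ⁿ

-- encode a b is a + 2b.
digit : Bool → Bool → Fin 4
digit false false = zero
digit true  false = suc zero
digit false true  = suc (suc zero)
digit true  true  = suc (suc (suc zero))

low high : Fin 4 → Bool
low zero                   = false
low (suc zero)             = true
low (suc (suc zero))       = false
low (suc (suc (suc zero))) = true
high zero                   = false
high (suc zero)             = false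
high (suc (suc zero))       = true
high (suc (suc (suc zero))) = true

encode : ∀ {n} → Bits n → Bits n → ℤmod 4 n
encode = zipWith digit

map-low-encode : ∀ {n} (a b : Bits n) → Vec.map low (encode a b) ≡ a
map-low-encode []      []      = refl
map-low-encode (a ∷ as) (b ∷ bs) = cong₂ _∷_ (low-digit a b) (map-low-encode as bs)
  where
  low-digit : ∀ a b → low (digit a b) ≡ a
  low-digit false false = refl
  low-digit false true  = refl
  low-digit true  false = refl
  low-digit true  true  = refl

map-high-encode : ∀ {n} (a b : Bits n) → Vec.map high (encode a b) ≡ b
map-high-encode []      []      = refl
map-high-encode (a ∷ as) (b ∷ bs) = cong₂ _∷_ (high-digit a b) (map-high-encode as bs)
  where
  high-digit : ∀ a b → high (digit a b) ≡ b
  high-digit false false = refl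
  high-digit false true  = refl
  high-digit true  false = refl
  high-digit true  true  = refl

encode-surjective : ∀ {n} (x : ℤmod 4 n) → encode (Vec.map low x) (Vec.map high x) ≡ x
encode-surjective []      = refl
encode-surjective (x ∷ xs) = cong₂ _∷_ (digit-surjective x) (encode-surjective xs)
  where
  digit-surjective : ∀ x → digit (low x) (high x) ≡ x
  digit-surjective zero                   = refl
  digit-surjective (suc zero)             = refl
  digit-surjective (suc (suc zero))       = refl
  digit-surjective (suc (suc (suc zero))) = refl

encode-injectiveˡ : ∀ {n} {a b a′ b′ : Bits n} → encode a b ≡ encode a′ b′ → a ≡ a′
encode-injectiveˡ {a = a} {b} {a′} {b′} eq =
  trans (sym (map-low-encode a b)) (trans (cong (Vec.map low) eq) (map-low-encode a′ b′))

encode-injectiveʳ : ∀ {n} {a b a′ b′ : Bits n} → encode a b ≡ encode a′ b′ → b ≡ b′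
encode-injectiveʳ {a = a} {b} {a′} {b′} eq =
  trans (sym (map-high-encode a b)) (trans (cong (Vec.map high) eq) (map-high-encode a′ b′))

-- The difference d with encode a b ⊕ d = encode (a ⊞ δ) c; the conjunction is the carry into the 2s place.
step : ∀ {n} → Bits n → Bits n → Bits n → Bits n → ℤmod 4 n
step a δ b c = encode δ ((b ⊞ c) ⊞ zipWith _∧_ a δ)

-- Two steps add 2δ, that is `δ` in the high bits. So the terms alternate between the fibres over
-- `a` and `a ⊞ δ`, where `b` and `c` are arbitrary.
term : ∀ {n} → Bits n → Bits n → Bits n → Bits n → Fin 4 → ℤmod 4 n
term a δ b c zero                   = encode a b
term a δ b c (suc zero)             = encode (a ⊞ δ) c
term a δ b c (suc (suc zero))       = encode a (b ⊞ δ)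
term a δ b c (suc (suc (suc zero))) = encode (a ⊞ δ) (c ⊞ δ)

-- One coordinate, checked by evaluating all 64 cases.
progression-bit : ∀ a δ b c i →
  progression 4 (encode (a ∷ []) (b ∷ [])) (step (a ∷ []) (δ ∷ []) (b ∷ []) (c ∷ [])) i ≡
  term (a ∷ []) (δ ∷ []) (b ∷ []) (c ∷ []) i
progression-bit a δ b c i = decidable-stable (equal? (a ∷ δ ∷ b ∷ c ∷ []) i) λ ≢ →
  from-no (∃? 4 λ v → Fin.any? (¬? ∘ equal? v)) (a ∷ δ ∷ b ∷ c ∷ [] , i , ≢)
  where
  Equal : Bits 4 → Fin 4 → Set
  Equal (a ∷ δ ∷ b ∷ c ∷ []) i =
    progression 4 (encode (a ∷ []) (b ∷ [])) (step (a ∷ []) (δ ∷ []) (b ∷ []) (c ∷ [])) i ≡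
    term (a ∷ []) (δ ∷ []) (b ∷ []) (c ∷ []) i
  equal? : ∀ v i → Dec (Equal v i)
  equal? (a ∷ δ ∷ b ∷ c ∷ []) i = Vec.≡-dec Fin._≟_ _ _

progression-step : ∀ {n} (a δ b c : Bits n) i → progression 4 (encode a b) (step a δ b c) i ≡ term a δ b c i
progression-step []       []       []       []       zero                   = refl
progression-step []       []       []       []       (suc zero)             = refl
progression-step []       []       []       []       (suc (suc zero))       = refl
progression-step []       []       []       []       (suc (suc (suc zero))) = refl
progression-step (a ∷ as) (δ ∷ δs) (b ∷ bs) (c ∷ cs) i@zero                   =
  cong₂ _∷_ (cong Vec.head (progression-bit a δ b c i)) (progression-step as δs bs cs i)
progression-step (a ∷ as) (δ ∷ δs) (b ∷ bs) (c ∷ cs) i@(suc zero)             =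
  cong₂ _∷_ (cong Vec.head (progression-bit a δ b c i)) (progression-step as δs bs cs i)
progression-step (a ∷ as) (δ ∷ δs) (b ∷ bs) (c ∷ cs) i@(suc (suc zero))       =
  cong₂ _∷_ (cong Vec.head (progression-bit a δ b c i)) (progression-step as δs bs cs i)
progression-step (a ∷ as) (δ ∷ δs) (b ∷ bs) (c ∷ cs) i@(suc (suc (suc zero))) =
  cong₂ _∷_ (cong Vec.head (progression-bit a δ b c i)) (progression-step as δs bs cs i)

-- Distinct terms differ by `δ` in the low bits if their indices have different parity, and in the
-- high bits otherwise.
term-injective : ∀ {n} (a δ b c : Bits n) → δ ≢ 𝟎 → ∀ {i j} → term a δ b c i ≡ term a δ b c j → i ≡ j
term-injective a δ b c δ≢𝟎 = go _ _
  where
  low-clash : ∀ {b c} → encode a b ≢ encode (a ⊞ δ) c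
  low-clash = δ≢𝟎 ∘ x≡x⊞y⇒y≡𝟎 ∘ encode-injectiveˡ
  high-clash : ∀ {a b} → encode a b ≢ encode a (b ⊞ δ)
  high-clash = δ≢𝟎 ∘ x≡x⊞y⇒y≡𝟎 ∘ encode-injectiveʳ
  go : ∀ i j → term a δ b c i ≡ term a δ b c j → i ≡ j
  go zero                   zero                   _  = refl
  go zero                   (suc zero)             eq = contradiction eq low-clash
  go zero                   (suc (suc zero))       eq = contradiction eq high-clash
  go zero                   (suc (suc (suc zero))) eq = contradiction eq low-clash
  go (suc zero)             zero                   eq = contradiction (sym eq) low-clash
  go (suc zero)             (suc zero)             _  = refl
  go (suc zero)             (suc (suc zero))       eq = contradiction (sym eq) low-clash
  go (suc zero)             (suc (suc (suc zero))) eq = contradiction eq high-clash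
  go (suc (suc zero))       zero                   eq = contradiction (sym eq) high-clash
  go (suc (suc zero))       (suc zero)             eq = contradiction eq low-clash
  go (suc (suc zero))       (suc (suc zero))       _  = refl
  go (suc (suc zero))       (suc (suc (suc zero))) eq = contradiction eq low-clash
  go (suc (suc (suc zero))) zero                   eq = contradiction (sym eq) low-clash
  go (suc (suc (suc zero))) (suc zero)             eq = contradiction (sym eq) high-clash
  go (suc (suc (suc zero))) (suc (suc zero))       eq = contradiction (sym eq) low-clash
  go (suc (suc (suc zero))) (suc (suc (suc zero))) _  = refl

-- Upper bounds

infix 4 _∈?_
_∈?_ : ∀ {n} (x : ℤmod 4 n) (S : List (ℤmod 4 n)) → Dec (x ∈ S)
_∈?_ = DecMembership._∈?_ (Vec.≡-dec Fin._≟_)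

fibres : ∀ {n} → List (ℤmod 4 n) → Bits n → Bits n → Bool
fibres S a b = does (encode a b ∈? S)

does⇒ : ∀ {A : Set} (a? : Dec A) → T (does a?) → A
does⇒ (yes a) _ = a

-- Two pairs of difference `δ`, one from each fibre, interleave to a proper progression.
fibres-separated : ∀ {n} (S : List (ℤmod 4 n)) → ¬ ContainsProperAP 4 S → Separated (fibres S)
fibres-separated S free a δ δ≢𝟎 (b , Sb , Sb′) (c , Sc , Sc′) =
  free (encode a b , step a δ b c , proper , λ i → subst (_∈ S) (sym (progression-step a δ b c i)) (terms i))
  where
  proper : Proper 4 (encode a b) (step a δ b c)
  proper {i} {j} eq = term-injective a δ b c δ≢𝟎
    (trans (sym (progression-step a δ b c i)) (trans eq (progression-step a δ b c j)))
  terms : ∀ i → term a δ b c i ∈ S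
  terms zero                   = does⇒ (_ ∈? S) Sb
  terms (suc zero)             = does⇒ (_ ∈? S) Sc
  terms (suc (suc zero))       = does⇒ (_ ∈? S) Sb′
  terms (suc (suc (suc zero))) = does⇒ (_ ∈? S) Sc′

-- Each new head adds 1 at its own code, where the fibres of the tail are still empty by uniqueness.
length≤total : ∀ {n} {S : List (ℤmod 4 n)} → Unique S → length S ≤ total (fibres S)
length≤total []                             = z≤n
length≤total {n} {x ∷ S} (x∉S ∷ unique) = begin
  1 + length S
    ≤⟨ +-mono-≤ one (length≤total unique) ⟩
  ∑ n (λ a → ∑ n (λ b → χ (isX a b))) + total (fibres S)
    ≡⟨ ∑-+ n (λ a → ∑ n (λ b → χ (isX a b))) (card ∘ fibres S) ⟨
  ∑ n (λ a → ∑ n (λ b → χ (isX a b)) + card (fibres S a))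
    ≡⟨ ∑-cong n (λ a → ∑-+ n (λ b → χ (isX a b)) (χ ∘ fibres S a)) ⟨
  ∑ n (λ a → ∑ n (λ b → χ (isX a b) + χ (fibres S a b)))
    ≤⟨ ∑-mono n (λ a → ∑-mono n (λ b → pointwise a b)) ⟩
  total (fibres (x ∷ S)) ∎
  where
  open ≤-Reasoning
  isX : Bits n → Bits n → Bool
  isX a b = does (Vec.≡-dec Fin._≟_ (encode a b) x)
  isX-true : χ (isX (Vec.map low x) (Vec.map high x)) ≡ 1
  isX-true = cong χ (dec-true (Vec.≡-dec Fin._≟_ _ x) (encode-surjective x))
  one : 1 ≤ ∑ n (λ a → ∑ n (λ b → χ (isX a b)))
  one = begin
    1                                                ≡⟨ isX-true ⟨
    χ (isX (Vec.map low x) (Vec.map high x))         ≤⟨ ≤-∑ (λ b → χ (isX (Vec.map low x) b)) (Vec.map high x) ⟩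
    ∑ n (λ b → χ (isX (Vec.map low x) b))            ≤⟨ ≤-∑ (λ a → ∑ n (λ b → χ (isX a b))) (Vec.map low x) ⟩
    ∑ n (λ a → ∑ n (λ b → χ (isX a b)))              ∎
  pointwise : ∀ a b → χ (isX a b) + χ (fibres S a b) ≤ χ (fibres (x ∷ S) a b)
  pointwise a b with Vec.≡-dec Fin._≟_ (encode a b) x | encode a b ∈? S | encode a b ∈? (x ∷ S)
  ... | yes refl | yes x∈S | _       = contradiction refl (All.lookup x∉S x∈S)
  ... | yes refl | no _    | yes _   = ≤-refl
  ... | yes refl | no _    | no x∉   = contradiction (here refl) x∉
  ... | no _     | yes _   | yes _   = ≤-refl
  ... | no _     | yes ∈S  | no x∉   = contradiction (there ∈S) x∉
  ... | no _     | no _    | _       = z≤n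

upperBound : ∀ {n N} → (∀ {F : Bits n → Bits n → Bool} → Separated F → total F ≤ N) →
             ∀ k → APFreeSetOfSize 4 4 n k → k ≤ N
upperBound bound k (S , unique , free , refl) = ≤-trans (length≤total unique) (bound (fibres-separated S free))

-- Extremal sets

bits : ∀ n → List (Bits n)
bits zero    = [] ∷ []
bits (suc n) = cartesianProductWith _∷_ (false ∷ true ∷ []) (bits n)

bits-unique : ∀ n → Unique (bits n)
bits-unique zero    = All.[] ∷ []
bits-unique (suc n) = Unique.cartesianProductWith⁺ _∷_ Vec.∷-injective (((λ ()) All.∷ All.[]) ∷ All.[] ∷ []) (bits-unique n)

elements : ∀ {n} → (Bits n → Bits n → Bool) → List (ℤmod 4 n)
elements {n} F = map (uncurry encode) (filter (T? ∘ uncurry F) (cartesianProduct (bits n) (bits n)))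

elements-unique : ∀ {n} (F : Bits n → Bits n → Bool) → Unique (elements F)
elements-unique {n} F = Unique.map⁺ (λ eq → cong₂ _,_ (encode-injectiveˡ eq) (encode-injectiveʳ eq))
  (Unique.filter⁺ (T? ∘ uncurry F) (Unique.cartesianProduct⁺ (bits-unique n) (bits-unique n)))

∈-elements : ∀ {n} (F : Bits n → Bits n → Bool) {a b} → encode a b ∈ elements F → T (F a b)
∈-elements F mem with ∈-map⁻ (uncurry encode) mem
... | (a , b) , mem′ , eq with encode-injectiveˡ eq | encode-injectiveʳ eq
...   | refl | refl = proj₂ (∈-filter⁻ (T? ∘ uncurry F) {xs = cartesianProduct (bits _) (bits _)} mem′)

elements-free : ∀ {n} (F : Bits n → Bits n → Bool) → Separated F → ¬ ContainsProperAP 4 (elements F)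
elements-free F sep (x , d , proper , mem) = sep a δ δ≢𝟎
  (b , ∈-elements F (mem′ zero) , ∈-elements F (mem′ (suc (suc zero))))
  (c , ∈-elements F (mem′ (suc zero)) , ∈-elements F (mem′ (suc (suc (suc zero)))))
  where
  a = Vec.map low x
  b = Vec.map high x
  δ = Vec.map low d
  k = zipWith _∧_ a δ
  -- Solves `step a δ b c ≡ d` for `c`; `k` is the carry.
  c = b ⊞ (Vec.map high d ⊞ k)
  d≡step : step a δ b c ≡ d
  d≡step = trans
    (cong (encode δ) (trans (cong (_⊞ k) (⊞-cancelˡ b _)) (⊞-cancelʳ (Vec.map high d) k)))
    (encode-surjective d)
  progression≡term : ∀ i → progression 4 x d i ≡ term a δ b c i
  progression≡term i = trans
    (cong₂ (λ y z → progression 4 y z i) (sym (encode-surjective x)) (sym d≡step))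
    (progression-step a δ b c i)
  mem′ : ∀ i → term a δ b c i ∈ elements F
  mem′ i = subst (_∈ elements F) (progression≡term i) (mem i)
  δ≢𝟎 : δ ≢ 𝟎
  -- An even `d` satisfies 2d = 0, so the terms with indices 0 and 2 would coincide.
  δ≢𝟎 δ≡𝟎 = contradiction (proper {zero} {suc (suc zero)} repeats) λ ()
    where
    open ≡-Reasoning
    repeats : progression 4 x d zero ≡ progression 4 x d (suc (suc zero))
    repeats = begin
      progression 4 x d zero              ≡⟨ progression≡term zero ⟩
      encode a b                          ≡⟨ cong (encode a) (⊞-identityʳ b) ⟨
      encode a (b ⊞ 𝟎)                    ≡⟨ cong (λ z → encode a (b ⊞ z)) δ≡𝟎 ⟨
      encode a (b ⊞ δ)                    ≡⟨ progression≡term (suc (suc zero)) ⟨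
      progression 4 x d (suc (suc zero))  ∎

separated? : ∀ {n} (F : Bits n → Bits n → Bool) →
             Dec (∃₂ λ a δ → δ ≢ 𝟎 × HasDiff (F a) δ × HasDiff (F (a ⊞ δ)) δ)
separated? {n} F = ∃? n λ a → ∃? n λ δ → ¬? (δ ≟ 𝟎) ×-dec hasDiff? (F a) δ ×-dec hasDiff? (F (a ⊞ δ)) δ

-- The size is left as a length, which evaluates to the required number for a concrete family.
lowerBound : ∀ {n} (F : Bits n → Bits n → Bool) →
             ¬ (∃₂ λ a δ → δ ≢ 𝟎 × HasDiff (F a) δ × HasDiff (F (a ⊞ δ)) δ) →
             APFreeSetOfSize 4 4 n (length (elements F))
lowerBound F sep = elements F , elements-unique F ,
  elements-free F (λ a δ δ≢𝟎 d d′ → sep (a , δ , δ≢𝟎 , d , d′)) , refl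

dot : ∀ {n} → Bits n → Bits n → Bool
dot []      []      = false
dot (x ∷ xs) (y ∷ ys) = (x ∧ y) xor dot xs ys

-- The fibre over a is the orthogonal complement of slopes a. The slopes were found by computer search;
-- among any two of them, over a and c, one is non-orthogonal to a ⊞ c.
orthogonal : ∀ {n} → (Bits n → Bits n) → Bits n → Bits n → Bool
orthogonal slopes a b = not (dot (slopes a) b)

slopes₃ : Bits 3 → Bits 3
slopes₃ (false ∷ false ∷ false ∷ []) = false ∷ false ∷ false ∷ []
slopes₃ (false ∷ false ∷ true ∷ []) = true ∷ false ∷ true ∷ []
slopes₃ (false ∷ true ∷ false ∷ []) = false ∷ true ∷ true ∷ []
slopes₃ (false ∷ true ∷ true ∷ []) = false ∷ true ∷ false ∷ []
slopes₃ (true ∷ false ∷ false ∷ []) = true ∷ true ∷ false ∷ []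
slopes₃ (true ∷ false ∷ true ∷ []) = false ∷ false ∷ true ∷ []
slopes₃ (true ∷ true ∷ false ∷ []) = true ∷ false ∷ false ∷ []
slopes₃ (true ∷ true ∷ true ∷ []) = true ∷ true ∷ true ∷ []

slopes₁ : Bits 1 → Bits 1
slopes₁ a = a

slopes₂ : Bits 2 → Bits 2
slopes₂ a = Vec.tail (slopes₃ (false ∷ a))

-- Slopes starting with `true` are nonzero, so all 16 fibres have 8 elements. For distinct `a` and
-- `c` exactly one of `table a` and `table c` is orthogonal to `a ⊞ c`, which covers both values of
-- the first coordinate of the difference.
slopes₄ : Bits 4 → Bits 4
slopes₄ (_ ∷ a) = true ∷ table a
  where
  table : Bits 3 → Bits 3
  table (false ∷ false ∷ false ∷ []) = true ∷ false ∷ false ∷ []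
  table (false ∷ false ∷ true ∷ []) = true ∷ false ∷ true ∷ []
  table (false ∷ true ∷ false ∷ []) = false ∷ true ∷ true ∷ []
  table (false ∷ true ∷ true ∷ []) = true ∷ true ∷ false ∷ []
  table (true ∷ false ∷ false ∷ []) = false ∷ false ∷ true ∷ []
  table (true ∷ false ∷ true ∷ []) = false ∷ true ∷ false ∷ []
  table (true ∷ true ∷ false ∷ []) = true ∷ true ∷ true ∷ []
  table (true ∷ true ∷ true ∷ []) = false ∷ false ∷ false ∷ []

theorem3p5 : (r[ 4 , 4 , 1 ]≡ 3) × (r[ 4 , 4 , 2 ]≡ 10) × (r[ 4 , 4 , 3 ]≡ 36) × (r[ 4 , 4 , 4 ]≡ 128)
theorem3p5 =
    -- For `m` = 0, 1, 2 the bound of `total≤` evaluates to 3, 10 and 36.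
    (lowerBound (orthogonal slopes₁) (from-no (separated? (orthogonal slopes₁))) , upperBound total≤)
  , (lowerBound (orthogonal slopes₂) (from-no (separated? (orthogonal slopes₂))) , upperBound total≤)
  , (lowerBound (orthogonal slopes₃) (from-no (separated? (orthogonal slopes₃))) , upperBound total≤)
  , (lowerBound (orthogonal slopes₄) (from-no (separated? (orthogonal slopes₄))) , upperBound total≤128)
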